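{- Let $n>2$ and $t$ be two positive integers. Then \[\varphi(P_n \boxdot K_t)= \begin{cases} t+2, & \text{if } n \leq t+3,\\ n-1, & \text{if } t+3<n\leq 2t+3,\\ 2t+3, & \text{otherwise}. \end{cases}\]
   Context: All graphs are finite and simple. $P_n$ and $K_n$ denote respectively the path and the complete graph with $n$ vertices. The subdivision graph $S(G)$ of a graph $G$ is obtained by inserting one new vertex into every edge of $G$. For graphs $G$ and $H$, with $V(G)=\{u_0,\ldots,u_{m-1}\}$, the subdivision-vertex neighbourhood corona (SVN corona) $G\boxdot H$ is the graph obtained from $S(G)$ by adding $m$ vertex-disjoint copies of $H$ (one for each $u_i$) and joining, for each $i$, every vertex of $N_{S(G)}(u_i)$ (the neighbourhood of $u_i$ in $S(G)$) to every vertex of the copy of $H$ associated with $u_i$. A $b$-chromatic coloring of a graph with $k$ colors is a proper coloring with colors $0,\ldots,k-1$ such that, for each color $i$, there is a vertex (a $b$-vertex) of color $i$ having, for each color $j\neq i$, a neighbour of color $j$. The $b$-chromatic number $\varphi(G)$ is the maximum $k$ for which $G$ has a $b$-chromatic coloring with $k$ colors. -}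

module Defs where

open import Data.Empty using (⊥)
open import Data.Fin using (Fin; zero; suc; toℕ; _<_)
open import Data.Fin.Properties using (+↔⊎; *↔×; inj⇒≟; _<?_)
import Data.Fin.Properties as Fin
open import Data.Irrelevant using ([_])
open import Data.Nat using (ℕ; zero; suc; _≤_; _*_)
import Data.Nat.Properties as ℕ
open import Data.Product using (Σ; ∃-syntax; _×_; _,_; proj₂)
open import Data.Product.Function.NonDependent.Propositional using (_×-↔_)
open import Data.Refinement using (Refinement; Refinement-syntax; value; _,_)
open import Data.Sum using (_⊎_; inj₁; inj₂; swap)
open import Data.Sum.Function.Propositional using (_⊎-↔_)
open import Function using (_∘_)
open import Function.Bundles using (_↔_; Inverse; mk↔ₛ′)
open import Function.Construct.Composition using (_↔-∘_)
open import Function.Construct.Identity using (↔-id)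
open import Function.Construct.Symmetry using (↔-sym)
open import Function.Properties.Inverse using (↔⇒↣)
open import Level using (Level)
open import Relation.Binary using (Decidable; DecidableEquality; Symmetric)
open import Relation.Binary.PropositionalEquality
  using (_≡_; _≢_; refl; sym; cong; subst; ≢-sym)
open import Relation.Nullary using (¬_; yes; no; contradiction)
open import Relation.Nullary.Decidable using (_×-dec_; _⊎-dec_; ¬?; recompute)
import Relation.Unary as U

private
  variable
    a p : Level
    A : Set a

-- A decidable subset of a finite type is finite.

private
  refinement-Fin : ∀ n {P : Fin n → Set p} → U.Decidable P →
                   ∃[ k ] [ x ∈ Fin n ∣ P x ] ↔ Fin k
  refinement-Fin zero P? = 0 , mk↔ₛ′ (λ { (() , _) }) (λ ()) (λ ()) (λ { (() , _) })
  refinement-Fin {p = p} (suc n) {P} P? with refinement-Fin n (P? ∘ suc) | P? zero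
  ... | k , i | yes p₀ = suc k , mk↔ₛ′ to from to-from from-to
    where
    module I = Inverse i
    to : [ x ∈ Fin (suc n) ∣ P x ] → Fin (suc k)
    to (zero  , _) = zero
    to (suc x , q) = suc (I.to (x , q))
    from : Fin (suc k) → [ x ∈ Fin (suc n) ∣ P x ]
    from zero    = zero , [ p₀ ]
    from (suc y) = let (x , q) = I.from y in suc x , q
    to-from : ∀ y → to (from y) ≡ y
    to-from zero    = refl
    to-from (suc y) = cong suc (I.strictlyInverseˡ y)
    from-to : ∀ x → from (to x) ≡ x
    from-to (zero  , _) = refl
    from-to (suc x , q) = cong (λ (z , r) → suc z , r) (I.strictlyInverseʳ (x , q))
  ... | k , i | no ¬p₀ = k , mk↔ₛ′ to from to-from from-to
    where
    module I = Inverse i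
    to : [ x ∈ Fin (suc n) ∣ P x ] → Fin k
    to (zero  , [ q ]) = contradiction (recompute (P? zero) q) ¬p₀
    to (suc x , q) = I.to (x , q)
    from : Fin k → [ x ∈ Fin (suc n) ∣ P x ]
    from y = let (x , q) = I.from y in suc x , q
    to-from : ∀ y → to (from y) ≡ y
    to-from = I.strictlyInverseˡ
    from-to : ∀ x → from (to x) ≡ x
    from-to (zero  , [ q ]) = contradiction (recompute (P? zero) q) ¬p₀
    from-to (suc x , q) = cong (λ (z , r) → suc z , r) (I.strictlyInverseʳ (x , q))

refinement-finite : ∀ {n} {P : A → Set p} → A ↔ Fin n → U.Decidable P →
                    ∃[ k ] [ x ∈ A ∣ P x ] ↔ Fin k
refinement-finite {A = A} {n = n} {P = P} i P? =
  let (k , j) = refinement-Fin n (P? ∘ I.from) in k , j ↔-∘ reindex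
  where
  module I = Inverse i
  Q : Fin n → Set _
  Q = P ∘ I.from
  ext : ∀ {B : Set a} {R : B → Set p} {x y : Refinement B R} → value x ≡ value y → x ≡ y
  ext refl = refl
  reindex : [ x ∈ A ∣ P x ] ↔ [ y ∈ Fin n ∣ Q y ]
  reindex = mk↔ₛ′
    (λ { (x , [ q ]) → I.to x , [ subst P (sym (I.strictlyInverseʳ x)) q ] })
    (λ { (y , q) → I.from y , q })
    (λ { (y , _) → ext (I.strictlyInverseˡ y) })
    (λ { (x , _) → ext (I.strictlyInverseʳ x) })

record Graph : Set₁ where
  infix 4 _~_ _~?_
  field
    V      : Set
    order  : ℕ
    finite : V ↔ Fin order
    _~_    : V → V → Set
    _~?_   : Decidable _~_
    ~-sym  : Symmetric _~_
    ~-irr  : ∀ {v} → ¬ v ~ v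

  index : V → Fin order
  index = Inverse.to finite

  _≟_ : DecidableEquality V
  _≟_ = inj⇒≟ (↔⇒↣ finite)

  -- Each undirected edge {u , v} is listed once, as the pair whose first
  -- component comes first in the enumeration of V.
  IsEdge : V × V → Set
  IsEdge (u , v) = index u < index v × u ~ v

  isEdge? : U.Decidable IsEdge
  isEdge? (u , v) = (index u <? index v) ×-dec (u ~? v)

  Edge : Set
  Edge = [ uv ∈ V × V ∣ IsEdge uv ]

  edges-finite : ∃[ k ] Edge ↔ Fin k
  edges-finite = refinement-finite (↔-sym *↔× ↔-∘ (finite ×-↔ finite)) isEdge?

  infix 4 _isEndOf_ _isEndOf?_
  _isEndOf_ : V → Edge → Set
  w isEndOf e = let (u , v) = value e in w ≡ u ⊎ w ≡ v

  _isEndOf?_ : Decidable _isEndOf_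
  w isEndOf? e = let (u , v) = value e in (w ≟ u) ⊎-dec (w ≟ v)

path : ℕ → Graph
path n = record
  { V      = Fin n
  ; order  = n
  ; finite = ↔-id _
  ; _~_    = λ i j → suc (toℕ i) ≡ toℕ j ⊎ suc (toℕ j) ≡ toℕ i
  ; _~?_   = λ i j → (suc (toℕ i) ℕ.≟ toℕ j) ⊎-dec (suc (toℕ j) ℕ.≟ toℕ i)
  ; ~-sym  = swap
  ; ~-irr  = λ { (inj₁ q) → ℕ.1+n≢n q ; (inj₂ q) → ℕ.1+n≢n q }
  }

complete : ℕ → Graph
complete n = record
  { V      = Fin n
  ; order  = n
  ; finite = ↔-id _
  ; _~_    = _≢_
  ; _~?_   = λ i j → ¬? (i Fin.≟ j)
  ; ~-sym  = ≢-sym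
  ; ~-irr  = λ i≢i → i≢i refl
  }

subdivision : Graph → Graph
subdivision G = record
  { V      = V ⊎ Edge
  ; finite = ↔-sym +↔⊎ ↔-∘ (finite ⊎-↔ proj₂ edges-finite)
  ; _~_    = _~ₛ_
  ; _~?_   = _~ₛ?_
  ; ~-sym  = λ {x} {y} → ~ₛ-sym x y
  ; ~-irr  = λ {x} → ~ₛ-irr x
  }
  where
  open Graph G

  _~ₛ_ : V ⊎ Edge → V ⊎ Edge → Set
  inj₁ u ~ₛ inj₁ v = ⊥
  inj₁ u ~ₛ inj₂ e = u isEndOf e
  inj₂ e ~ₛ inj₁ u = u isEndOf e
  inj₂ e ~ₛ inj₂ f = ⊥

  _~ₛ?_ : Decidable _~ₛ_
  inj₁ u ~ₛ? inj₁ v = no λ ()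
  inj₁ u ~ₛ? inj₂ e = u isEndOf? e
  inj₂ e ~ₛ? inj₁ u = u isEndOf? e
  inj₂ e ~ₛ? inj₂ f = no λ ()

  ~ₛ-sym : ∀ x y → x ~ₛ y → y ~ₛ x
  ~ₛ-sym (inj₁ u) (inj₂ e) q = q
  ~ₛ-sym (inj₂ e) (inj₁ u) q = q

  ~ₛ-irr : ∀ x → ¬ x ~ₛ x
  ~ₛ-irr (inj₁ u) ()
  ~ₛ-irr (inj₂ e) ()

-- The subdivision-vertex neighbourhood corona; inj₂ (u , x) is the vertex x
-- in the copy of H associated with the vertex u of G.

infixl 6 _⊡_
_⊡_ : Graph → Graph → Graph
G ⊡ H = record
  { V      = S.V ⊎ (G.V × H.V)
  ; finite = ↔-sym +↔⊎ ↔-∘ (S.finite ⊎-↔ (↔-sym *↔× ↔-∘ (G.finite ×-↔ H.finite)))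
  ; _~_    = _~ₙ_
  ; _~?_   = _~ₙ?_
  ; ~-sym  = λ {x} {y} → ~ₙ-sym x y
  ; ~-irr  = λ {x} → ~ₙ-irr x
  }
  where
  module G = Graph G
  module H = Graph H
  module S = Graph (subdivision G)

  _~ₙ_ : S.V ⊎ (G.V × H.V) → S.V ⊎ (G.V × H.V) → Set
  inj₁ w       ~ₙ inj₁ z       = w S.~ z
  inj₁ w       ~ₙ inj₂ (u , x) = inj₁ u S.~ w
  inj₂ (u , x) ~ₙ inj₁ w       = inj₁ u S.~ w
  inj₂ (u , x) ~ₙ inj₂ (v , y) = u ≡ v × x H.~ y

  _~ₙ?_ : Decidable _~ₙ_
  inj₁ w       ~ₙ? inj₁ z       = w S.~? z
  inj₁ w       ~ₙ? inj₂ (u , x) = inj₁ u S.~? w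
  inj₂ (u , x) ~ₙ? inj₁ w       = inj₁ u S.~? w
  inj₂ (u , x) ~ₙ? inj₂ (v , y) = (u G.≟ v) ×-dec (x H.~? y)

  ~ₙ-sym : ∀ x y → x ~ₙ y → y ~ₙ x
  ~ₙ-sym (inj₁ w)       (inj₁ z)       q       = S.~-sym {w} {z} q
  ~ₙ-sym (inj₁ w)       (inj₂ _)       q       = q
  ~ₙ-sym (inj₂ _)       (inj₁ w)       q       = q
  ~ₙ-sym (inj₂ (u , x)) (inj₂ (v , y)) (r , q) = sym r , H.~-sym q

  ~ₙ-irr : ∀ x → ¬ x ~ₙ x
  ~ₙ-irr (inj₁ w)       q       = S.~-irr {w} q
  ~ₙ-irr (inj₂ (u , x)) (_ , q) = H.~-irr q

module _ (G : Graph) where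
  open Graph G

  IsProper : ∀ {k} → (V → Fin k) → Set
  IsProper c = ∀ {u v} → u ~ v → c u ≢ c v

  IsBVertex : ∀ {k} → (V → Fin k) → V → Set
  IsBVertex c v = ∀ j → j ≢ c v → ∃[ w ] v ~ w × c w ≡ j

  IsBColoring : ∀ {k} → (V → Fin k) → Set
  IsBColoring c = IsProper c × (∀ i → ∃[ v ] c v ≡ i × IsBVertex c v)

  HasBColoring : ℕ → Set
  HasBColoring k = Σ (V → Fin k) IsBColoring

  IsBChromaticNumber : ℕ → Set
  IsBChromaticNumber k = HasBColoring k × (∀ l → HasBColoring l → l ≤ k)

module Submission where

-- Upper bound: a closed neighbourhood has at most t + 2 vertices, except around
-- the n - 1 subdivision vertices, where it has 2t + 3.  So with more than t + 2
-- colours every b-vertex is a subdivision vertex, whence at most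
-- min (n - 1) (2t + 3) colours.
--
-- Lower bound: for k = t + 3 + x colours with x ≤ t and k < n, use the residues
-- mod k.  Colour the subdivision vertex e_i by i, and u_i together with the i-th
-- copy of K_t by i + D, where D ⊆ {1 , … , k - 2} has t + 1 elements and no two
-- consecutive elements of {0 , … , k - 1} are both outside D.  Then the
-- neighbourhood of e_i carries i + (D ∪ (D + 1)), i.e. every colour except i.
-- For t + 2 colours, give e_0 colour 0, every other e_i colour 1 and all copies
-- of K_t the remaining t colours: e_0, e_1 and the second copy are b-vertices.

open import Defs
open import Data.Nat using (ℕ; _+_; _*_; _∸_; _<_; _≤?_; _<?_)
open import Data.Bool using (if_then_else_; _∧_)
open import Relation.Nullary using (does)
open import Data.Bool using (Bool)
open import Data.Empty using (⊥)
open import Data.Fin using (Fin; zero; suc; toℕ; fromℕ<)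
import Data.Fin.Properties as Fin
open import Data.Fin.Properties using (+↔⊎; *↔×)
open import Data.Fin.Patterns using (0F; 1F; 2F)
open import Data.Irrelevant using ([_])
open import Data.Nat using (zero; suc; pred; _≤_; _⊓_; _%_; z≤n; s≤s; NonZero)
open import Data.Nat.DivMod using (_mod_; %-distribˡ-+; [m+n]%n≡m%n; m≤n⇒[n∸m]%m≡n%m;
  m<n⇒m%n≡m; m%n<n)
open import Data.Nat.Properties
open import Data.Product using (∃-syntax; _×_; _,_; proj₁; proj₂)
open import Data.Product.Function.NonDependent.Propositional using (_×-↔_)
open import Data.Refinement using (value; _,_)
open import Data.Sum using (_⊎_; inj₁; inj₂)
open import Data.Sum.Function.Propositional using (_⊎-↔_)
open import Data.Sum.Properties using (inj₁-injective; inj₂-injective)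
open import Data.Unit using (⊤; tt)
open import Function using (_∘_)
open import Function.Bundles using (_↣_; Injection)
open import Function.Construct.Composition using (_↔-∘_)
open import Function.Construct.Identity using (↔-id)
open import Function.Construct.Symmetry using (↔-sym)
open import Function.Properties.Inverse using (↔⇒↣)
open import Relation.Binary.Definitions using (tri<; tri≈; tri>)
open import Relation.Binary.PropositionalEquality
open import Relation.Nullary using (Dec; yes; no; ¬_; contradiction)
open import Relation.Nullary.Decidable using (recompute)

-- Counting colours around a b-vertex.

module _ (G : Graph) where
  open Graph G

  InClosedNeighbourhood : V → V → Set
  InClosedNeighbourhood v w = v ≡ w ⊎ v ~ w

  -- A b-vertex sees every colour in its closed neighbourhood, its own colour at itself. One witness
  -- per colour gives distinct vertices there, so any code separating the closed neighbourhood
  -- bounds the number of colours; no degree has to be computed.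
  bVertex⇒colours≤ : ∀ {l m} {C : Set} {c : V → Fin l} {v} →
    IsBVertex G c v → C ↣ Fin m → (code : V → C) →
    (∀ {w z} → InClosedNeighbourhood v w → InClosedNeighbourhood v z →
       code w ≡ code z → w ≡ z) →
    l ≤ m
  bVertex⇒colours≤ {l} {c = c} {v} b C↣m code code-inj =
    Fin.injective⇒≤ {f = Injection.to C↣m ∘ code ∘ proj₁ ∘ witness} λ {i} {j} eq →
      let (w , w∈ , cw) = witness i; (z , z∈ , cz) = witness j
      in trans (sym cw)
           (trans (cong c (code-inj w∈ z∈ (Injection.injective C↣m eq))) cz)
    where
    witness : ∀ j → ∃[ w ] InClosedNeighbourhood v w × c w ≡ j
    witness j with j Fin.≟ c v
    ... | yes j≡cv = v , inj₁ refl , sym j≡cv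
    ... | no  j≢cv = let (w , v~w , cw) = b j j≢cv in w , inj₂ v~w , cw

-- Edges of a path and their two ends.

module PathEdges (n : ℕ) where
  open Graph (path n) using (Edge; isEdge?; _isEndOf_) public

  lower upper : Edge → Fin n
  lower = proj₁ ∘ value
  upper = proj₂ ∘ value

  -- Listing the smaller index first rules out the descending form of adjacency. The membership
  -- proof is irrelevant, so it is rebuilt from decidability.
  toℕ-upper : ∀ e → toℕ (upper e) ≡ suc (toℕ (lower e))
  toℕ-upper ((u , v) , [ p ]) with recompute (isEdge? (u , v)) p
  ... | _   , inj₁ q = sym q
  ... | u<v , inj₂ q = contradiction (≤-trans (n≤1+n _) (≤-reflexive q)) (<⇒≱ u<v)

  edge-ext : ∀ {e f : Edge} → value e ≡ value f → e ≡ f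
  edge-ext refl = refl

  lower-injective : ∀ {e f} → lower e ≡ lower f → e ≡ f
  lower-injective {e} {f} eq = edge-ext (cong₂ (λ u v → u , v) eq (Fin.toℕ-injective
    (trans (toℕ-upper e) (trans (cong (suc ∘ toℕ) eq) (sym (toℕ-upper f))))))

  upper-injective : ∀ {e f} → upper e ≡ upper f → e ≡ f
  upper-injective {e} {f} eq = lower-injective (Fin.toℕ-injective (suc-injective
    (trans (sym (toℕ-upper e)) (trans (cong toℕ eq) (toℕ-upper f)))))

  lower-bound : ∀ e → toℕ (lower e) < pred n
  lower-bound e = ≤-trans (≤-reflexive (sym (toℕ-upper e))) (Fin.toℕ≤pred[n] (upper e))

  edgeFrom : ∀ i → suc i < n → Edge
  edgeFrom i i+1<n = (fromℕ< i<n , fromℕ< i+1<n) ,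
    [ subst₂ _<_ (sym (Fin.toℕ-fromℕ< i<n)) (sym (Fin.toℕ-fromℕ< i+1<n)) (n<1+n i)
    , inj₁ (trans (cong suc (Fin.toℕ-fromℕ< i<n)) (sym (Fin.toℕ-fromℕ< i+1<n))) ]
    where
    i<n : i < n
    i<n = <-trans (n<1+n i) i+1<n

  toℕ-lower-edgeFrom : ∀ i (i+1<n : suc i < n) → toℕ (lower (edgeFrom i i+1<n)) ≡ i
  toℕ-lower-edgeFrom i i+1<n = Fin.toℕ-fromℕ< _

  -- This one bit separates both the at most two edges at a vertex and the two ends of an edge; it
  -- is the source of the factors 2 in the bounds.
  isLower : Edge → Fin n → Bool
  isLower e u = does (lower e Fin.≟ u)

  isLower-injectiveˡ : ∀ {u e f} → u isEndOf e → u isEndOf f →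
    isLower e u ≡ isLower f u → e ≡ f
  isLower-injectiveˡ {u} {e} {f} p q eq with lower e Fin.≟ u | lower f Fin.≟ u
  ... | yes r | yes s = lower-injective (trans r (sym s))
  isLower-injectiveˡ (inj₁ p) q        eq | no r | no s = contradiction (sym p) r
  isLower-injectiveˡ (inj₂ p) (inj₁ q) eq | no r | no s = contradiction (sym q) s
  isLower-injectiveˡ (inj₂ p) (inj₂ q) eq | no r | no s = upper-injective (trans (sym p) q)

  isLower-injectiveʳ : ∀ {u v e} → u isEndOf e → v isEndOf e →
    isLower e u ≡ isLower e v → u ≡ v
  isLower-injectiveʳ {u} {v} {e} p q eq with lower e Fin.≟ u | lower e Fin.≟ v
  ... | yes r | yes s = trans (sym r) s
  isLower-injectiveʳ (inj₁ p) q        eq | no r | no s = contradiction (sym p) r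
  isLower-injectiveʳ (inj₂ p) (inj₁ q) eq | no r | no s = contradiction (sym q) s
  isLower-injectiveʳ (inj₂ p) (inj₂ q) eq | no r | no s = trans p (sym q)

-- Adjacency in the corona and the upper bounds.

module Corona (n t : ℕ) where
  open PathEdges n public

  G : Graph
  G = path n ⊡ complete t

  open Graph G using (V; _~_) public

  pattern vertex u = inj₁ (inj₁ u)
  pattern edge e   = inj₁ (inj₂ e)
  pattern copy u x = inj₂ (u , x)

  -- `vertex u` and every `copy u x` are adjacent to the same subdivision vertices, so these `suc t`
  -- vertices are treated uniformly.
  slot : Fin n → Fin (suc t) → V
  slot u zero    = vertex u
  slot u (suc x) = copy u x

  edge~slot : ∀ e u s → u isEndOf e → edge e ~ slot u s
  edge~slot e u zero    p = p
  edge~slot e u (suc x) p = p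

  properIfLocally : ∀ {k} (c : V → Fin k) →
    (∀ e u s → u isEndOf e → c (slot u s) ≢ c (edge e)) →
    (∀ u {x y} → x ≢ y → c (copy u x) ≢ c (copy u y)) →
    IsProper G c
  properIfLocally c es qs {vertex u} {edge e}   p = es e u zero p
  properIfLocally c es qs {edge e}   {vertex u} p = ≢-sym (es e u zero p)
  properIfLocally c es qs {edge e}   {copy u x} p = ≢-sym (es e u (suc x) p)
  properIfLocally c es qs {copy u x} {edge e}   p = es e u (suc x) p
  properIfLocally c es qs {copy u x} {copy u y} (refl , p) = qs u p

  -- No slot has both a vertex of the path and a vertex of a copy in its closed
  -- neighbourhood, so the vertices of the path may share the code of x.
  nonEdgeCode : Fin t → Fin n → V → Fin t ⊎ Bool
  nonEdgeCode x u (vertex _) = inj₁ x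
  nonEdgeCode x u (edge e)   = inj₂ (isLower e u)
  nonEdgeCode x u (copy _ y) = inj₁ y

  nonEdgeCode-injective : ∀ x u s {w z} →
    InClosedNeighbourhood G (slot u s) w → InClosedNeighbourhood G (slot u s) z →
    nonEdgeCode x u w ≡ nonEdgeCode x u z → w ≡ z
  nonEdgeCode-injective x u zero = go
    where
    go : ∀ {w z} →
      InClosedNeighbourhood G (vertex u) w → InClosedNeighbourhood G (vertex u) z →
      nonEdgeCode x u w ≡ nonEdgeCode x u z → w ≡ z
    go (inj₁ refl) (inj₁ refl) eq = refl
    go {z = edge f} (inj₁ refl) (inj₂ q) ()
    go {w = edge e} (inj₂ p) (inj₁ refl) ()
    go {edge e} {edge f} (inj₂ p) (inj₂ q) eq =
      cong (inj₁ ∘ inj₂) (isLower-injectiveˡ p q (inj₂-injective eq))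
  nonEdgeCode-injective x u (suc x₁) p q eq = go (near p) (near q) eq
    where
    -- For a copy vertex, being the centre or a neighbour of it is merged into lying in the same
    -- copy: its name in `Fin t` then determines it.
    Near : V → Set
    Near (vertex _) = ⊥
    Near (edge e)   = u isEndOf e
    Near (copy v _) = u ≡ v
    near : ∀ {w} → InClosedNeighbourhood G (copy u x₁) w → Near w
    near (inj₁ refl) = refl
    near {edge e}   (inj₂ p)       = p
    near {copy v y} (inj₂ (p , _)) = p
    go : ∀ {w z} → Near w → Near z → nonEdgeCode x u w ≡ nonEdgeCode x u z → w ≡ z
    go {edge e} {edge f} p q eq =
      cong (inj₁ ∘ inj₂) (isLower-injectiveˡ p q (inj₂-injective eq))
    go {copy _ y} {copy _ z} refl refl refl = refl
    go {edge e} {copy _ _} p q ()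
    go {copy _ _} {edge e} p q ()

  -- The summands count the two adjacent copies, the subdivision vertex itself and its two ends:
  -- `2 * t + (1 + 2)`.
  edgeCode : Edge → V → (Bool × Fin t) ⊎ (⊤ ⊎ Bool)
  edgeCode e (vertex u) = inj₂ (inj₂ (isLower e u))
  edgeCode e (edge _)   = inj₂ (inj₁ tt)
  edgeCode e (copy u y) = inj₁ (isLower e u , y)

  edgeCode-injective : ∀ e {w z} →
    InClosedNeighbourhood G (edge e) w → InClosedNeighbourhood G (edge e) z →
    edgeCode e w ≡ edgeCode e z → w ≡ z
  edgeCode-injective e p q eq = go (near p) (near q) eq
    where
    Near : V → Set
    Near (vertex u) = u isEndOf e
    Near (edge f)   = e ≡ f
    Near (copy u _) = u isEndOf e
    near : ∀ {w} → InClosedNeighbourhood G (edge e) w → Near w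
    near (inj₁ refl) = refl
    near {vertex u} (inj₂ p) = p
    near {copy u _} (inj₂ p) = p
    go : ∀ {w z} → Near w → Near z → edgeCode e w ≡ edgeCode e z → w ≡ z
    go {vertex _} {vertex _} p q eq =
      cong (inj₁ ∘ inj₁) (isLower-injectiveʳ {e = e} p q (inj₂-injective (inj₂-injective eq)))
    go {edge _}   {edge _} refl refl eq = refl
    go {copy _ _} {copy _ _} p q eq =
      cong₂ (λ u y → copy u y) (isLower-injectiveʳ {e = e} p q (cong proj₁ (inj₁-injective eq)))
                               (cong proj₂ (inj₁-injective eq))
    go {vertex _} {edge _}   p q ()
    go {vertex _} {copy _ _} p q ()
    go {edge _}   {vertex _} p q ()
    go {edge _}   {copy _ _} p q ()
    go {copy _ _} {vertex _} p q ()
    go {copy _ _} {edge _}   p q ()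

  module _ {l} {c : V → Fin l} where

    nonEdge-bVertex : 0 < t → ∀ u s → IsBVertex G c (slot u s) → l ≤ t + 2
    nonEdge-bVertex 0<t u s b = bVertex⇒colours≤ G {c = c} b
      (↔⇒↣ (↔-sym +↔⊎ ↔-∘ (↔-id _ ⊎-↔ ↔-sym Fin.2↔Bool)))
      (nonEdgeCode x u) (nonEdgeCode-injective x u s)
      where
      -- Positivity of `t` provides the code that the path vertices borrow.
      x : Fin t
      x = fromℕ< 0<t

    edge-bVertex : ∀ e → IsBVertex G c (edge e) → l ≤ 2 * t + 3
    edge-bVertex e b = bVertex⇒colours≤ G {c = c} b
      (↔⇒↣ (↔-sym +↔⊎ ↔-∘ ((↔-sym *↔× ↔-∘ (↔-sym Fin.2↔Bool ×-↔ ↔-id _)) ⊎-↔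
            (↔-sym +↔⊎ ↔-∘ (↔-sym Fin.1↔⊤ ⊎-↔ ↔-sym Fin.2↔Bool)))))
      (edgeCode e) (edgeCode-injective e)

    -- Distinct colours need distinct subdivision vertices. These are determined by their lower
    -- ends, and the last path vertex is never a lower end.
    edge-bVertices : (∀ i → ∃[ e ] c (edge e) ≡ i) → l ≤ n ∸ 1
    edge-bVertices es = Fin.injective⇒≤ {f = λ i → fromℕ< (lower-bound (proj₁ (es i)))}
      λ {i} {j} eq → trans (sym (proj₂ (es i))) (trans
        (cong (λ e → c (edge e)) (lower-injective (Fin.toℕ-injective
          (Fin.fromℕ<-injective _ _ _ _ eq))))
        (proj₂ (es j)))

  colours-bound : 0 < t → ∀ l → HasBColoring G l →
    l ≤ t + 2 ⊎ (l ≤ n ∸ 1 × l ≤ 2 * t + 3)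
  -- With no colours there is no b-vertex to inspect; otherwise colour `zero` supplies the edge used
  -- for `2 * t + 3`.
  colours-bound 0<t zero    _            = inj₁ z≤n
  colours-bound 0<t (suc l) (c , _ , bs) with suc l ≤? t + 2
  ... | yes l≤t+2 = inj₁ l≤t+2
  ... | no  l≰t+2 = inj₂
    ( edge-bVertices {c = c} (λ i → let (e , ce , _) = edges i in e , ce)
    , (let (e , _ , b) = edges zero in edge-bVertex e b) )
    where
    edges : ∀ i → ∃[ e ] c (edge e) ≡ i × IsBVertex G c (edge e)
    edges i with bs i
    ... | vertex u , _  , b = contradiction (nonEdge-bVertex 0<t u zero b) l≰t+2
    ... | edge e   , ce , b = e , ce , b
    ... | copy u x , _  , b = contradiction (nonEdge-bVertex 0<t u (suc x) b) l≰t+2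


-- The colouring with two more colours than a copy has vertices.

module SmallColouring (m t : ℕ) where
  open Corona (3 + m) (suc t)

  -- Since `e₁` has colour 1 and contains the second path vertex, `e₀` must get colour 1 from the
  -- first one. The third path vertex supplies colour 0 to `e₁`. The second lies on both edges, so
  -- it reuses the copy colour 2.
  vertexColour edgeColour : Fin (3 + m) → Fin (3 + t)
  vertexColour 0F            = 1F
  vertexColour 1F            = 2F
  vertexColour (suc (suc _)) = 0F
  edgeColour zero    = 0F
  edgeColour (suc _) = 1F

  colour : V → Fin (3 + t)
  colour (vertex u) = vertexColour u
  colour (edge e)   = edgeColour (lower e)
  colour (copy _ x) = suc (suc x)

  -- Colour 1 occurs only at the first path vertex, which lies on the edge of colour 0 alone; colour
  -- 0 occurs only at indices from 2 on, off that edge.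
  vertexColour≢edgeColour : ∀ u a → u ≡ a ⊎ toℕ u ≡ suc (toℕ a) →
    vertexColour u ≢ edgeColour a
  vertexColour≢edgeColour 0F            zero    _        ()
  vertexColour≢edgeColour 0F            (suc _) (inj₁ ())
  vertexColour≢edgeColour 0F            (suc _) (inj₂ ())
  vertexColour≢edgeColour 1F            zero    _        ()
  vertexColour≢edgeColour 1F            (suc _) _        ()
  vertexColour≢edgeColour (suc (suc _)) zero    (inj₁ ())
  vertexColour≢edgeColour (suc (suc _)) zero    (inj₂ ())
  vertexColour≢edgeColour (suc (suc _)) (suc _) _        ()

  copyColour≢edgeColour : ∀ (x : Fin (suc t)) a → suc (suc x) ≢ edgeColour a
  copyColour≢edgeColour x zero    ()
  copyColour≢edgeColour x (suc _) ()

  colour-proper : IsProper G colour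
  colour-proper {u} {v} = properIfLocally colour edges (λ _ x≢y eq →
    x≢y (Fin.suc-injective (Fin.suc-injective eq))) {u} {v}
    where
    edges : ∀ e u s → u isEndOf e → colour (slot u s) ≢ colour (edge e)
    edges e u zero    (inj₁ p) = vertexColour≢edgeColour u (lower e) (inj₁ p)
    edges e u zero    (inj₂ p) = vertexColour≢edgeColour u (lower e)
      (inj₂ (trans (cong toℕ p) (toℕ-upper e)))
    edges e u (suc x) _        = copyColour≢edgeColour x (lower e)

  e₀ e₁ : Edge
  e₀ = edgeFrom 0 (s≤s (s≤s z≤n))
  e₁ = edgeFrom 1 (s≤s (s≤s (s≤s z≤n)))

  hasBColoring : HasBColoring G (3 + t)
  hasBColoring = colour , (λ {u} {v} → colour-proper {u} {v}) , λ
    { 0F            → edge e₀ , refl , λ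
      { 0F j≢ → contradiction refl j≢
      ; 1F _  → vertex 0F , inj₁ refl , refl
      ; (suc (suc y)) _ → copy 0F y , inj₁ refl , refl }
    ; 1F            → edge e₁ , refl , λ
      { 0F _  → vertex 2F , inj₂ refl , refl
      ; 1F j≢ → contradiction refl j≢
      ; (suc (suc y)) _ → copy 1F y , inj₁ refl , refl }
    ; (suc (suc x)) → copy 1F x , refl , λ
      { 0F _  → edge e₀ , inj₂ refl , refl
      ; 1F _  → edge e₁ , inj₁ refl , refl
      ; (suc (suc y)) j≢ → copy 1F y , (refl , λ { refl → j≢ refl }) , refl } }

-- Shifts and differences of residues.

module Residues (k : ℕ) .{{_ : NonZero k}} where

  mod⇒% : ∀ a b → a mod k ≡ b mod k → a % k ≡ b % k
  mod⇒% a b = Fin.fromℕ<-injective _ _ _ _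

  toℕ-mod : ∀ a → toℕ (a mod k) ≡ a % k
  toℕ-mod a = Fin.toℕ-fromℕ< (m%n<n a k)

  %≡⇒mod≡ : ∀ a {j : Fin k} → a % k ≡ toℕ j → a mod k ≡ j
  %≡⇒mod≡ a eq = Fin.toℕ-injective (trans (toℕ-mod a) eq)

  -- Adding `d` to the remainder either stays below `k` and increases it, or wraps once and
  -- decreases it, since `d < k`.
  %-shift-≢ : ∀ a {d} → 0 < d → d < k → (a + d) % k ≢ a % k
  %-shift-≢ a {d} 0<d d<k eq = shifted (a % k + d <? k)
    where
    reduce : (a % k + d) % k ≡ a % k
    reduce = trans (cong (λ e → (a % k + e) % k) (sym (m<n⇒m%n≡m d<k)))
                   (trans (sym (%-distribˡ-+ a d k)) eq)
    shifted : ¬ Dec (a % k + d < k)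
    shifted (yes r+d<k) = <⇒≢ (m<m+n (a % k) 0<d) (trans (sym reduce) (m<n⇒m%n≡m r+d<k))
    shifted (no  r+d≮k) = <⇒≢ wrapped<r (trans (sym (m<n⇒m%n≡m wrapped<k))
      (trans (m≤n⇒[n∸m]%m≡n%m k≤r+d) reduce))
      where
      k≤r+d : k ≤ a % k + d
      k≤r+d = ≮⇒≥ r+d≮k
      wrapped<r : a % k + d ∸ k < a % k
      wrapped<r = subst (a % k + d ∸ k <_) (m+n∸n≡m (a % k) k)
        (∸-monoˡ-< (+-monoʳ-< (a % k) d<k) k≤r+d)
      wrapped<k : a % k + d ∸ k < k
      wrapped<k = <-trans wrapped<r (m%n<n a k)

  -- `d` represents `j - i` modulo `k`; when `j` lies below `i` one period is added, as
  -- `j + (k - i)`, to avoid truncated subtraction.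
  residue-difference : ∀ (i j : Fin k) → j ≢ i →
    ∃[ d ] 0 < d × d < k × (toℕ i + d) mod k ≡ j
  residue-difference i j j≢i with toℕ i <? toℕ j
  ... | yes i<j = toℕ j ∸ toℕ i , m<n⇒0<n∸m i<j , ≤-<-trans (m∸n≤m (toℕ j) (toℕ i)) (Fin.toℕ<n j) ,
    %≡⇒mod≡ _ (trans (cong (_% k) (m+[n∸m]≡n (<⇒≤ i<j))) (m<n⇒m%n≡m (Fin.toℕ<n j)))
  ... | no  i≮j = toℕ j + (k ∸ toℕ i) , ≤-trans (m<n⇒0<n∸m (Fin.toℕ<n i)) (m≤n+m _ _) ,
    subst (toℕ j + (k ∸ toℕ i) <_) (m+[n∸m]≡n i≤k) (+-monoˡ-< (k ∸ toℕ i) j<i) ,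
    %≡⇒mod≡ _ (trans (cong (_% k) i+[j+[k-i]]≡j+k)
      (trans ([m+n]%n≡m%n (toℕ j) k) (m<n⇒m%n≡m (Fin.toℕ<n j))))
    where
    i≤k : toℕ i ≤ k
    i≤k = <⇒≤ (Fin.toℕ<n i)
    j<i : toℕ j < toℕ i
    j<i = ≤∧≢⇒< (≮⇒≥ i≮j) (j≢i ∘ Fin.toℕ-injective)
    i+[j+[k-i]]≡j+k : toℕ i + (toℕ j + (k ∸ toℕ i)) ≡ toℕ j + k
    i+[j+[k-i]]≡j+k = begin
      toℕ i + (toℕ j + (k ∸ toℕ i)) ≡⟨ +-assoc (toℕ i) (toℕ j) _ ⟨
      toℕ i + toℕ j + (k ∸ toℕ i)   ≡⟨ cong (_+ (k ∸ toℕ i)) (+-comm (toℕ i) (toℕ j)) ⟩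
      toℕ j + toℕ i + (k ∸ toℕ i)   ≡⟨ +-assoc (toℕ j) (toℕ i) _ ⟩
      toℕ j + (toℕ i + (k ∸ toℕ i)) ≡⟨ cong (toℕ j +_) (m+[n∸m]≡n i≤k) ⟩
      toℕ j + k                     ∎
      where open ≡-Reasoning

-- The offset set D, enumerated increasingly.

module Gap (x : ℕ) where

  -- Steps of 2 first, then of 1: gap 0 = 1, and gap t = t + 1 + x when x ≤ t.
  gap : ℕ → ℕ
  gap s = suc (s + s ⊓ x)

  gap≤ : ∀ {s t} → s ≤ t → gap s ≤ suc (t + x)
  gap≤ {s} s≤t = s≤s (+-mono-≤ s≤t (m⊓n≤n s x))

  gap-mono-< : ∀ {r s} → r < s → gap r < gap s
  gap-mono-< r<s = s≤s (+-mono-<-≤ r<s (⊓-monoˡ-≤ x (<⇒≤ r<s)))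

  gap-injective : ∀ {r s} → gap r ≡ gap s → r ≡ s
  gap-injective {r} {s} eq with <-cmp r s
  ... | tri< r<s _ _ = contradiction eq (<⇒≢ (gap-mono-< r<s))
  ... | tri≈ _ r≡s _ = r≡s
  ... | tri> _ _ s<r = contradiction (sym eq) (<⇒≢ (gap-mono-< s<r))

  gap-suc : ∀ s → gap (suc s) ≡ suc (gap s) ⊎ gap (suc s) ≡ suc (suc (gap s))
  gap-suc s with s <? x
  ... | yes s<x = inj₂ (trans (cong (λ y → suc (suc s + y)) (m≤n⇒m⊓n≡m s<x))
    (trans (cong (2 +_) (+-suc s s))
      (cong (λ y → 3 + (s + y)) (sym (m≤n⇒m⊓n≡m (<⇒≤ s<x))))))
  ... | no  s≮x = inj₁ (cong (λ y → 2 + (s + y))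
    (trans (m≥n⇒m⊓n≡n (m≤n⇒m≤1+n (≮⇒≥ s≮x))) (sym (m≥n⇒m⊓n≡n (≮⇒≥ s≮x)))))

  -- The values start at 1, grow by at most 2 and end at `suc (t + x)`, so no two consecutive
  -- numbers in this range are both missed. In the induction, a value already at `suc d` is kept,
  -- and a value at `d` is replaced by the next one.
  gap-covers : ∀ {t} → x ≤ t → ∀ d → d ≤ suc (t + x) →
    ∃[ s ] s ≤ t × (gap s ≡ suc d ⊎ gap s ≡ d)
  gap-covers x≤t zero    _    = 0 , z≤n , inj₁ refl
  gap-covers {t} x≤t (suc d) d+1≤ with gap-covers x≤t d (<⇒≤ d+1≤)
  ... | s , s≤t , inj₁ eq = s , s≤t , inj₂ eq
  ... | s , s≤t , inj₂ eq = step (gap-suc s)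
    where
    -- A next value exists: `gap t` is `suc (t + x)`, which exceeds `d`.
    s<t : s < t
    s<t = ≤∧≢⇒< s≤t λ { refl → <⇒≢ d+1≤
      (trans (sym eq) (cong (λ y → suc (s + y)) (m≥n⇒m⊓n≡n x≤t))) }
    step : _ → ∃[ s ] s ≤ t × (gap s ≡ suc (suc d) ⊎ gap s ≡ suc d)
    step (inj₁ e) = suc s , s<t , inj₂ (trans e (cong suc eq))
    step (inj₂ e) = suc s , s<t , inj₁ (trans e (cong (2 +_) eq))

-- The cyclic colouring with `3 + (t + x)` colours.

module CyclicColouring (n t x : ℕ) (x≤t : x ≤ t) (k<n : 3 + (t + x) < n) where
  open Corona n t
  open Gap x

  k : ℕ
  k = 3 + (t + x)

  open Residues k

  -- The colour before reduction modulo `k`. The path vertex takes the offset `gap 0` and its copy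
  -- the remaining `t` offsets.
  phase : V → ℕ
  phase (vertex u) = toℕ u + gap 0
  phase (edge e)   = toℕ (lower e)
  phase (copy u y) = toℕ u + gap (suc (toℕ y))

  phase-slot : ∀ u s → phase (slot u s) ≡ toℕ u + gap (toℕ s)
  phase-slot u zero    = refl
  phase-slot u (suc y) = refl

  -- The upper end has index one more than the lower, so the edge sees its offsets shifted by one:
  -- this is the set D + 1.
  phase-upperSlot : ∀ e s → phase (slot (upper e) s) ≡ toℕ (lower e) + suc (gap (toℕ s))
  phase-upperSlot e s = trans (phase-slot (upper e) s)
    (trans (cong (_+ gap (toℕ s)) (toℕ-upper e)) (sym (+-suc (toℕ (lower e)) (gap (toℕ s)))))

  colour : V → Fin k
  colour v = phase v mod k

  shift-≢ : ∀ {v w} d → 0 < d → d < k → phase v ≡ phase w + d → colour v ≢ colour w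
  shift-≢ {v} {w} d 0<d d<k eq cv≡cw = %-shift-≢ (phase w) 0<d d<k
    (trans (cong (_% k) (sym eq)) (mod⇒% (phase v) (phase w) cv≡cw))

  -- A slot differs from its two subdivision vertices by `gap` and `suc (gap)`. Keeping both below
  -- `k` makes them nonzero residues, hence the colouring proper there.
  gap<k-1 : ∀ (s : Fin (suc t)) → suc (gap (toℕ s)) < k
  gap<k-1 s = s≤s (s≤s (gap≤ (Fin.toℕ≤pred[n] s)))

  copies-≢ : ∀ u {r s : Fin t} → toℕ r < toℕ s → colour (copy u s) ≢ colour (copy u r)
  copies-≢ u {r} {s} r<s = shift-≢ {copy u s} {copy u r} (gs ∸ gr) (m<n⇒0<n∸m gr<gs)
    (≤-<-trans (m∸n≤m gs gr) (<-trans (n<1+n gs) (gap<k-1 (suc s))))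
    (trans (cong (toℕ u +_) (sym (m+[n∸m]≡n (<⇒≤ gr<gs)))) (sym (+-assoc (toℕ u) gr _)))
    where
    gr gs : ℕ
    gr = gap (suc (toℕ r))
    gs = gap (suc (toℕ s))
    gr<gs : gr < gs
    gr<gs = gap-mono-< (s≤s r<s)

  colour-proper : IsProper G colour
  colour-proper {u} {v} = properIfLocally colour edges copies {u} {v}
    where
    edges : ∀ e u s → u isEndOf e → colour (slot u s) ≢ colour (edge e)
    edges e u s (inj₁ refl) = shift-≢ {slot u s} {edge e} (gap (toℕ s)) (s≤s z≤n)
      (<-trans (n<1+n _) (gap<k-1 s)) (phase-slot u s)
    edges e u s (inj₂ refl) = shift-≢ {slot u s} {edge e} (suc (gap (toℕ s))) (s≤s z≤n)
      (gap<k-1 s) (phase-upperSlot e s)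
    copies : ∀ u {r s} → r ≢ s → colour (copy u r) ≢ colour (copy u s)
    copies u {r} {s} r≢s with <-cmp (toℕ r) (toℕ s)
    ... | tri< r<s _ _ = ≢-sym (copies-≢ u r<s)
    ... | tri≈ _ r≡s _ = contradiction (Fin.toℕ-injective r≡s) r≢s
    ... | tri> _ _ s<r = copies-≢ u s<r

  slot-cover : ∀ d → 0 < d → d < k →
    ∃[ s ] (gap (toℕ {suc t} s) ≡ d ⊎ suc (gap (toℕ s)) ≡ d)
  slot-cover (suc d) _ (s≤s d<) with gap-covers x≤t d (≤-pred d<)
  ... | s , s≤t , eq = fromℕ< (s≤s s≤t) , found eq
    where
    gap-s : gap (toℕ (fromℕ< (s≤s s≤t))) ≡ gap s
    gap-s = cong gap (Fin.toℕ-fromℕ< (s≤s s≤t))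
    found : _ → _
    found (inj₁ eq) = inj₁ (trans gap-s eq)
    found (inj₂ eq) = inj₂ (cong suc (trans gap-s eq))

  bVertex-of-colour : ∀ i → ∃[ v ] colour v ≡ i × IsBVertex G colour v
  bVertex-of-colour i = edge e , colour-e , bVertex
    where
    -- The hypothesis `k<n` ensures that the path has an edge of index `i` for every colour `i`.
    i+1<n : suc (toℕ i) < n
    i+1<n = ≤-<-trans (Fin.toℕ<n i) k<n
    e : Edge
    e = edgeFrom (toℕ i) i+1<n
    lower-e : toℕ (lower e) ≡ toℕ i
    lower-e = toℕ-lower-edgeFrom (toℕ i) i+1<n
    colour-e : colour (edge e) ≡ i
    colour-e = %≡⇒mod≡ (toℕ (lower e)) (trans (cong (_% k) lower-e) (m<n⇒m%n≡m (Fin.toℕ<n i)))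
    bVertex : IsBVertex G colour (edge e)
    bVertex j j≢ with residue-difference i j (λ j≡i → j≢ (trans j≡i (sym colour-e)))
    -- An offset in D is realised at the lower end, one in D + 1 at the upper end.
    ... | d , 0<d , d<k , eq with slot-cover d 0<d d<k
    ... | s , inj₁ gap≡d = slot (lower e) s , edge~slot e (lower e) s (inj₁ refl) ,
      trans (cong (_mod k) (trans (phase-slot (lower e) s) (cong₂ _+_ lower-e gap≡d))) eq
    ... | s , inj₂ gap≡d = slot (upper e) s , edge~slot e (upper e) s (inj₂ refl) ,
      trans (cong (_mod k) (trans (phase-upperSlot e s) (cong₂ _+_ lower-e gap≡d))) eq

  hasBColoring : HasBColoring G k
  hasBColoring = colour , (λ {u} {v} → colour-proper {u} {v}) , bVertex-of-colour

-- Choice of parameters and the three cases.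

2*t+3≡3+[t+t] : ∀ t → 2 * t + 3 ≡ 3 + (t + t)
2*t+3≡3+[t+t] t = trans (+-comm (2 * t) 3) (cong (λ u → 3 + (t + u)) (+-identityʳ t))

bColoring-small : ∀ n t → 2 < n → 0 < t → HasBColoring (path n ⊡ complete t) (t + 2)
bColoring-small (suc (suc (suc m))) (suc t) (s≤s (s≤s (s≤s _))) _ =
  subst (HasBColoring (path (3 + m) ⊡ complete (suc t))) (+-comm 2 (suc t))
    (SmallColouring.hasBColoring m t)

bColoring-middle : ∀ n t → t + 3 < n → n ≤ 2 * t + 3 →
  HasBColoring (path n ⊡ complete t) (n ∸ 1)
bColoring-middle n@(suc n-1) t t+3<n n≤2t+3 = subst (HasBColoring (path n ⊡ complete t)) k≡n-1
  (CyclicColouring.hasBColoring n t x x≤t (s≤s (≤-reflexive k≡n-1)))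
  where
  -- Chosen to make the number of colours `n-1`; `x ≤ t` then follows from `n ≤ 2 * t + 3`.
  x : ℕ
  x = n-1 ∸ (3 + t)
  x≤t : x ≤ t
  x≤t = m≤n+o⇒m∸n≤o n-1 (3 + t)
    (≤-trans (n≤1+n n-1) (≤-trans n≤2t+3 (≤-reflexive (2*t+3≡3+[t+t] t))))
  k≡n-1 : 3 + (t + x) ≡ n-1
  k≡n-1 = m+[n∸m]≡n (≤-trans (≤-reflexive (+-comm 3 t)) (≤-pred t+3<n))

bColoring-large : ∀ n t → 2 * t + 3 < n → HasBColoring (path n ⊡ complete t) (2 * t + 3)
bColoring-large n t 2t+3<n = subst (HasBColoring (path n ⊡ complete t)) (sym (2*t+3≡3+[t+t] t))
  -- Taking `x = t` makes all steps 2: D consists of the odd numbers up to `2 * t + 1`.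
  (CyclicColouring.hasBColoring n t t ≤-refl
    (≤-trans (s≤s (≤-reflexive (sym (2*t+3≡3+[t+t] t)))) 2t+3<n))

theorem9 : (n t : ℕ) → 2 < n → 0 < t →
    IsBChromaticNumber (path n ⊡ complete t)
    (if does (n ≤? t + 3) then t + 2
    else if does (t + 3 <? n) ∧ does (n ≤? 2 * t + 3) then n ∸ 1
    else 2 * t + 3)
theorem9 n t 2<n 0<t = byCases (n ≤? t + 3) (t + 3 <? n) (n ≤? 2 * t + 3)
  where
  G : Graph
  G = path n ⊡ complete t
  t+2≤t+3 : t + 2 ≤ t + 3
  t+2≤t+3 = +-monoʳ-≤ t (n≤1+n 2)
  bound : ∀ {k} → t + 2 ≤ k → n ∸ 1 ≤ k ⊎ 2 * t + 3 ≤ k → ∀ l → HasBColoring G l → l ≤ k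
  bound t+2≤k _ l c with Corona.colours-bound n t 0<t l c
  bound t+2≤k _           l c | inj₁ l≤t+2        = ≤-trans l≤t+2 t+2≤k
  bound _ (inj₁ n-1≤k)    l c | inj₂ (l≤n-1 , _)  = ≤-trans l≤n-1 n-1≤k
  bound _ (inj₂ 2t+3≤k)   l c | inj₂ (_ , l≤2t+3) = ≤-trans l≤2t+3 2t+3≤k
  -- Abstracting the three decisions lets matching on them reduce the conditionals.
  byCases : (p? : Dec (n ≤ t + 3)) (q? : Dec (t + 3 < n)) (r? : Dec (n ≤ 2 * t + 3)) →
    IsBChromaticNumber G
      (if does p? then t + 2 else if does q? ∧ does r? then n ∸ 1 else 2 * t + 3)
  -- Here `n ∸ 1 ≤ t + 2`, so both alternatives of the upper bound give `t + 2`.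
  byCases (yes n≤t+3) _ _ = bColoring-small n t 2<n 0<t , bound ≤-refl
    (inj₁ (≤-trans (∸-monoˡ-≤ 1 n≤t+3) (≤-reflexive (+-∸-assoc t (s≤s (z≤n {2}))))))
  byCases (no n≰t+3) (no t+3≮n) _ = contradiction (≰⇒> n≰t+3) t+3≮n
  byCases (no _) (yes t+3<n) (yes n≤2t+3) = bColoring-middle n t t+3<n n≤2t+3 ,
    bound (≤-trans t+2≤t+3 (∸-monoˡ-≤ 1 t+3<n)) (inj₁ ≤-refl)
  byCases (no _) (yes _) (no n≰2t+3) = bColoring-large n t (≰⇒> n≰2t+3) ,
    bound (≤-trans t+2≤t+3 (+-monoˡ-≤ 3 (m≤m+n t (t + 0)))) (inj₂ ≤-refl)
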